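{- For any integer $t\ge 2$, there is a constant $C(t)$, depending only on $t$, such that ${\rm sat}^*\!\left(n,\left(\binom{2t}{t}+1\right)C_2\right)\le C(t)$ for all positive integers $n$.
   Context: For a poset $P=(P,\leqslant)$, a family $\mathcal{G}$ of sets is a (induced) copy of $P$ if there is a bijection $b:P\to\mathcal{G}$ such that $p\leqslant q$ if and only if $b(p)\subseteq b(q)$. A family $\mathcal{F}\subseteq 2^{[n]}$ is induced $P$-saturated if $\mathcal{F}$ contains no copy of $P$, but for every $G\in 2^{[n]}\setminus\mathcal{F}$ the family $\mathcal{F}\cup\{G\}$ contains a copy of $P$. ${\rm sat}^*(n,P)$ is the minimum size of an induced $P$-saturated family $\mathcal{F}\subseteq 2^{[n]}$. $C_2$ is the two-element chain and $mC_2$ denotes the disjoint union of $m$ pairwise incomparable copies of $C_2$. -}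

module Defs where

open import Data.Nat using (ℕ; _≤_)
open import Data.Fin using (Fin) renaming (_≤_ to _≤ᶠ_)
open import Data.Fin.Subset using (Subset; _⊆_)
open import Data.Product using (Σ; _×_; _,_)
open import Data.List using (List; _∷_; length)
open import Data.List.Membership.Propositional using (_∈_; _∉_)
open import Data.List.Relation.Unary.Unique.Propositional using (Unique)
open import Function.Bundles using (_⇔_)
open import Function.Definitions using (Injective)
open import Relation.Binary.PropositionalEquality using (_≡_)
open import Relation.Nullary using (¬_)

-- A family of subsets of [n] = {0,…,n-1}, represented as a list of
-- subsets; genuine families (sets) are lists without repetition.
Family : ℕ → Set
Family n = List (Subset n)

-- A (finite) poset P is given by a carrier type and its order relation.
-- An (induced) copy of P in a family 𝓕 is an injective map b : P → 𝓕
-- (a bijection onto its image 𝒢 ⊆ 𝓕) with  p ≤ q  iff  b p ⊆ b q.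
ContainsCopy : {A : Set} (_≼_ : A → A → Set) {n : ℕ} → Family n → Set
ContainsCopy {A} _≼_ {n} 𝓕 =
  Σ (A → Subset n) λ b →
    Injective _≡_ _≡_ b
    × (∀ p → b p ∈ 𝓕)
    × (∀ p q → (p ≼ q) ⇔ (b p ⊆ b q))

Saturated : {A : Set} (_≼_ : A → A → Set) {n : ℕ} → Family n → Set
Saturated _≼_ {n} 𝓕 =
  ¬ ContainsCopy _≼_ 𝓕
  × (∀ (G : Subset n) → G ∉ 𝓕 → ContainsCopy _≼_ (G ∷ 𝓕))

mC₂ : (m : ℕ) → Fin m × Fin 2 → Fin m × Fin 2 → Set
mC₂ m (i , a) (j , b) = (i ≡ j) × (a ≤ᶠ b)

SatStar≤ : {A : Set} (_≼_ : A → A → Set) (n C : ℕ) → Set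
SatStar≤ _≼_ n C =
  Σ (Family n) λ 𝓕 → Unique 𝓕 × Saturated _≼_ 𝓕 × (length 𝓕 ≤ C)

{-# OPTIONS --safe #-}

-- C(2t,t) is even, and sat*(n,(2q+1)C₂) is bounded for every q.  Fix a partition
-- of [n] into 4 + q singletons and one large block R.  If a family 𝓕₀ of unions
-- of blocks contains no copy of (2q+1)C₂ but acquires one with every set that
-- splits R, then adding unions of blocks greedily makes it saturated, and its
-- size stays bounded in terms of q.
--
-- For q = 1 such an 𝓕₀ lives on the four singletons 0, 1, 2, 3 and R: the sets
-- 0, 1, 2, 3, 03, 12 without R and the sets 123, 023, 013, 012, 02, 13 with R.
-- In general, take q copies of this gadget, the s-th one marked by the s-th of
-- the remaining q singletons, so that different copies are incomparable.  A set
-- G splitting R that contains exactly one marker s completes three C₂ in the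
-- s-th copy, while every other copy supplies two.  The other sets G leave two C₂
-- in every copy incomparable to them, without R if G has no marker and with R if
-- it has two; they form a further C₂ with the set 0123R or with a pair of
-- markers, which are incomparable to everything else in 𝓕₀.

module Submission where

open import Defs
open import Data.Nat using (ℕ; _≤_; _+_; _*_)
open import Data.Nat.Combinatorics using (_C_)
open import Data.Product using (∃-syntax)
open import Data.Nat using (zero; suc; _^_; _∸_; z≤n; s≤s)
open import Data.Nat.Combinatorics using (nCk≡nC[n∸k]; nCk+nC[k+1]≡[n+1]C[k+1])
import Data.Nat.Properties as ℕ
import Data.Bool.Properties as Bool
open import Data.Empty using (⊥-elim)
open import Data.Fin using (Fin; zero; suc; inject₁; combine; remQuot; _≟_) renaming (_≤_ to _≤ᶠ_; _<_ to _<ᶠ_)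
open import Data.Fin.Patterns using (0F; 1F; 2F)
import Data.Fin.Properties as Fin
open import Data.Fin.Subset using (Subset; Nonempty; _⊆_; _⊈_; ⊥; ⊤; ⁅_⁆; _∪_; inside; outside) renaming (_∈_ to _∈ˢ_; _∉_ to _∉ˢ_)
open import Data.Fin.Subset.Properties using (_⊆?_; _∈?_; nonempty?; Empty-unique; ⊆-reflexive; ⊆-antisym; ⊥⊆; ⊆⊤; ∈⊤; ∉⊥; x∈⁅x⁆; x∈⁅y⁆⇒x≡y; x∈p∪q⁺; x∈p∪q⁻; drop-∷-⊆)
open import Data.List using (List; []; _∷_; _++_; [_]; map; filter; length; cartesianProduct; cartesianProductWith; deduplicate; allFin)
open import Data.List.Membership.Propositional using (_∈_; _∉_; find; lose)
open import Data.List.Membership.Propositional.Properties using (∈-filter⁺; ∈-filter⁻; ∈-cartesianProduct⁺; ∈-cartesianProduct⁻; ∈-cartesianProductWith⁺; ∈-cartesianProductWith⁻; ∈-map⁺; ∈-map⁻; ∈-++⁺ˡ; ∈-++⁺ʳ; ∈-++⁻; ∈-allFin; ∈-deduplicate⁺; ∈-deduplicate⁻)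
open import Data.List.Properties using (length-map; length-++; length-deduplicate)
open import Data.List.Relation.Unary.All as All using ()
open import Data.List.Relation.Unary.All.Properties using (¬Any⇒All¬)
open import Data.List.Relation.Unary.AllPairs using ([]; _∷_)
open import Data.List.Relation.Unary.Any using (Any; here; there; any?)
open import Data.List.Relation.Unary.Unique.Propositional using (Unique)
import Data.List.Relation.Unary.Unique.DecPropositional.Properties as Unique
open import Data.Maybe using (Maybe; just; nothing)
open import Data.Maybe.Properties using (just-injective)
open import Data.Product using (Σ; _×_; _,_; proj₁; proj₂)
open import Data.Sum using (_⊎_; inj₁; inj₂)
open import Data.Unit using (tt) renaming (⊤ to Unit)
open import Data.Vec as Vec using ([]; _∷_; here; there)
import Data.Vec.Properties as Vec
open import Function using (_∘_; case_of_)
open import Function.Bundles using (mk⇔; Equivalence)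
open import Function.Definitions using (Injective)
open import Relation.Binary using (Decidable)
open import Relation.Binary.PropositionalEquality using (_≡_; _≢_; refl; sym; trans; cong; cong₂; subst; subst₂; module ≡-Reasoning)
open import Relation.Nullary using (¬_; Dec; yes; no; contradiction)
open import Relation.Nullary.Decidable using (map′; ¬?; _×-dec_; toWitness; toWitnessFalse)

-- Matchings and their transport along maps

-- For i ≢ j, lo⋠hi makes both elements of edge i incomparable to both elements of
-- edge j, so on subsets a matching indexed by Fin m is a copy of mC₂.
record Matching {A : Set} (_≼_ : A → A → Set) (I : Set) (P : A → Set) : Set where
  field
    lo hi : I → A
    lo∈   : ∀ i → P (lo i)
    hi∈   : ∀ i → P (hi i)
    lo≼hi : ∀ i → lo i ≼ hi i
    hi⋠lo : ∀ i → ¬ (hi i ≼ lo i)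
    lo⋠hi : ∀ {i j} → i ≢ j → ¬ (lo i ≼ hi j)

open Matching public

module _ {A : Set} {_≼_ : A → A → Set} where

  weaken : ∀ {I} {P Q : A → Set} → (∀ {x} → P x → Q x) → Matching _≼_ I P → Matching _≼_ I Q
  weaken P⊆Q M = record
    { lo = lo M ; hi = hi M ; lo∈ = P⊆Q ∘ lo∈ M ; hi∈ = P⊆Q ∘ hi∈ M
    ; lo≼hi = lo≼hi M ; hi⋠lo = hi⋠lo M ; lo⋠hi = lo⋠hi M }

  reindex : ∀ {I J} {P : A → Set} (f : J → I) → Injective _≡_ _≡_ f →
            Matching _≼_ I P → Matching _≼_ J P
  reindex f f-inj M = record
    { lo = lo M ∘ f ; hi = hi M ∘ f ; lo∈ = lo∈ M ∘ f ; hi∈ = hi∈ M ∘ f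
    ; lo≼hi = λ i → lo≼hi M (f i) ; hi⋠lo = λ i → hi⋠lo M (f i)
    ; lo⋠hi = λ i≢j → lo⋠hi M (i≢j ∘ f-inj) }

  addEdge : ∀ {I} {P : A → Set} (M : Matching _≼_ I P) {a b : A} → P a → P b →
            a ≼ b → ¬ (b ≼ a) → (∀ i → ¬ (lo M i ≼ b)) → (∀ i → ¬ (a ≼ hi M i)) →
            Matching _≼_ (Maybe I) P
  addEdge M {a} {b} Pa Pb a≼b b⋠a lo⋠b a⋠hi = record
    { lo    = λ { nothing → a ; (just i) → lo M i }
    ; hi    = λ { nothing → b ; (just i) → hi M i }
    ; lo∈   = λ { nothing → Pa ; (just i) → lo∈ M i }
    ; hi∈   = λ { nothing → Pb ; (just i) → hi∈ M i }
    ; lo≼hi = λ { nothing → a≼b ; (just i) → lo≼hi M i }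
    ; hi⋠lo = λ { nothing → b⋠a ; (just i) → hi⋠lo M i }
    ; lo⋠hi = λ { {nothing} {nothing} i≢j → contradiction refl i≢j
                ; {nothing} {just j}  _   → a⋠hi j
                ; {just i}  {nothing} _   → lo⋠b i
                ; {just i}  {just j}  i≢j → lo⋠hi M (i≢j ∘ cong just) } }

module _ {A B : Set} {_≼_ : A → A → Set} {_≼′_ : B → B → Set} (f : A → B)
         (f-mono : ∀ {x y} → x ≼ y → f x ≼′ f y)
         (f-cancel : ∀ {x y} → f x ≼′ f y → x ≼ y) where

  image : ∀ {I} {P : A → Set} {Q : B → Set} → (∀ {x} → P x → Q (f x)) →
          Matching _≼_ I P → Matching _≼′_ I Q
  image P⇒Q M = record
    { lo = f ∘ lo M ; hi = f ∘ hi M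
    ; lo∈ = P⇒Q ∘ lo∈ M ; hi∈ = P⇒Q ∘ hi∈ M
    ; lo≼hi = λ i → f-mono (lo≼hi M i)
    ; hi⋠lo = λ i → hi⋠lo M i ∘ f-cancel
    ; lo⋠hi = λ i≢j → lo⋠hi M i≢j ∘ f-cancel }

  preimage : ∀ {I} {P : A → Set} {Q : B → Set} → (∀ {y} → Q y → ∃[ x ] P x × y ≡ f x) →
             Matching _≼′_ I Q → Matching _≼_ I P
  preimage {I} {P} Q⇒P M = record
    { lo = proj₁ ∘ lo′ ; hi = proj₁ ∘ hi′
    ; lo∈ = proj₁ ∘ proj₂ ∘ lo′ ; hi∈ = proj₁ ∘ proj₂ ∘ hi′
    ; lo≼hi = λ i → f-cancel (subst₂ _≼′_ (lo-eq i) (hi-eq i) (lo≼hi M i))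
    ; hi⋠lo = λ i → hi⋠lo M i ∘ subst₂ _≼′_ (sym (hi-eq i)) (sym (lo-eq i)) ∘ f-mono
    ; lo⋠hi = λ {i} {j} i≢j → lo⋠hi M i≢j ∘ subst₂ _≼′_ (sym (lo-eq i)) (sym (hi-eq j)) ∘ f-mono }
    where
    lo′ : ∀ i → ∃[ x ] P x × lo M i ≡ f x
    lo′ i = Q⇒P (lo∈ M i)
    hi′ : ∀ i → ∃[ x ] P x × hi M i ≡ f x
    hi′ i = Q⇒P (hi∈ M i)
    lo-eq : ∀ i → lo M i ≡ f (proj₁ (lo′ i))
    lo-eq i = proj₂ (proj₂ (lo′ i))
    hi-eq : ∀ i → hi M i ≡ f (proj₁ (hi′ i))
    hi-eq i = proj₂ (proj₂ (hi′ i))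

-- Copies of `mC₂` as matchings of subsets

copy⇒matching : ∀ {m n} {𝓕 : Family n} → ContainsCopy (mC₂ m) 𝓕 → Matching _⊆_ (Fin m) (_∈ 𝓕)
copy⇒matching (b , b-inj , b∈ , b-emb) = record
  { lo    = λ i → b (i , 0F)
  ; hi    = λ i → b (i , 1F)
  ; lo∈   = λ i → b∈ (i , 0F)
  ; hi∈   = λ i → b∈ (i , 1F)
  ; lo≼hi = λ i → Equivalence.to (b-emb (i , 0F) (i , 1F)) (refl , z≤n)
  ; hi⋠lo = λ i hi⊆lo → case proj₂ (Equivalence.from (b-emb (i , 1F) (i , 0F)) hi⊆lo) of λ ()
  ; lo⋠hi = λ {i} {j} i≢j lo⊆hi → i≢j (proj₁ (Equivalence.from (b-emb (i , 0F) (j , 1F)) lo⊆hi)) }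

mC₂-antisym : ∀ {m} {p q} → mC₂ m p q → mC₂ m q p → p ≡ q
mC₂-antisym (refl , a≤b) (_ , b≤a) = cong (_ ,_) (Fin.≤-antisym a≤b b≤a)

matching⇒copy : ∀ {m n} {𝓕 : Family n} → Matching _⊆_ (Fin m) (_∈ 𝓕) → ContainsCopy (mC₂ m) 𝓕
matching⇒copy {m} {n} {𝓕} M = b , b-inj , b∈ , λ p q → mk⇔ (b-mono p q) (b-cancel p q)
  where
  b : Fin m × Fin 2 → Subset n
  b (i , 0F) = lo M i
  b (i , 1F) = hi M i

  b∈ : ∀ p → b p ∈ 𝓕
  b∈ (i , 0F) = lo∈ M i
  b∈ (i , 1F) = hi∈ M i

  lo⊆b : ∀ p → lo M (proj₁ p) ⊆ b p
  lo⊆b (i , 0F) x∈ = x∈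
  lo⊆b (i , 1F) x∈ = lo≼hi M i x∈

  b⊆hi : ∀ p → b p ⊆ hi M (proj₁ p)
  b⊆hi (i , 0F) x∈ = lo≼hi M i x∈
  b⊆hi (i , 1F) x∈ = x∈

  b-mono : ∀ p q → mC₂ m p q → b p ⊆ b q
  b-mono (i , 0F) (.i , 0F) (refl , _)  x∈ = x∈
  b-mono (i , 0F) (.i , 1F) (refl , _)  x∈ = lo≼hi M i x∈
  b-mono (i , 1F) (.i , 1F) (refl , _)  x∈ = x∈
  b-mono (i , 1F) (.i , 0F) (refl , ()) x∈

  side : ∀ i a c → b (i , a) ⊆ b (i , c) → a ≤ᶠ c
  side i 0F c  _     = z≤n
  side i 1F 0F hi⊆lo = ⊥-elim (hi⋠lo M i hi⊆lo)
  side i 1F 1F _     = s≤s z≤n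

  b-cancel : ∀ p q → b p ⊆ b q → mC₂ m p q
  b-cancel (i , a) (j , c) bp⊆bq with i ≟ j
  ... | yes refl = refl , side i a c bp⊆bq
  -- Going down from `b p` and up from `b q` turns an inclusion between different edges into one of
  -- a `lo` in a `hi`.
  ... | no i≢j   = ⊥-elim (lo⋠hi M i≢j λ x∈ → b⊆hi (j , c) (bp⊆bq (lo⊆b (i , a) x∈)))

  b-inj : Injective _≡_ _≡_ b
  b-inj {p} {q} bp≡bq = mC₂-antisym
    (b-cancel p q (⊆-reflexive bp≡bq)) (b-cancel q p (⊆-reflexive (sym bp≡bq)))

-- Deciding whether a matching exists

module _ {A : Set} {_≼_ : A → A → Set} (_≼?_ : Decidable _≼_) where

  Edge : A × A → Set
  Edge (a , b) = (a ≼ b) × (¬ (b ≼ a))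

  edge? : ∀ e → Dec (Edge e)
  edge? (a , b) = (a ≼? b) ×-dec ¬? (b ≼? a)

  Indep : A × A → A × A → Set
  Indep (a , b) (c , d) = (¬ (a ≼ d)) × (¬ (c ≼ b))

  indep? : Decidable Indep
  indep? (a , b) (c , d) = ¬? (a ≼? d) ×-dec ¬? (c ≼? b)

  -- With independent edges regarded as adjacent, a matching of `k` edges is a clique. The recursion
  -- picks a vertex and continues inside its neighbourhood, which prunes the search.
  Clique : ℕ → List (A × A) → Set
  Clique zero    es = Unit
  Clique (suc k) es = Any (λ e → Clique k (filter (indep? e) es)) es

  clique? : ∀ k es → Dec (Clique k es)
  clique? zero    es = yes tt
  clique? (suc k) es = any? (λ e → clique? k (filter (indep? e) es)) es

  PairwiseIndep : ∀ {k} → List (A × A) → (Fin k → A × A) → Set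
  PairwiseIndep es f = (∀ i → f i ∈ es) × (∀ {i j} → i ≢ j → ¬ (proj₁ (f i) ≼ proj₂ (f j)))

  clique⇒indep : ∀ k {es} → Clique k es → ∃[ f ] PairwiseIndep {k} es f
  clique⇒indep zero    _ = (λ ()) , (λ ()) , λ { {()} }
  clique⇒indep (suc k) {es} c with find c
  ... | e , e∈ , c′ with clique⇒indep k c′
  ... | f , f∈ , f-ind = g , g∈ , g-ind
    where
    f∈′ : ∀ i → f i ∈ es × Indep e (f i)
    f∈′ i = ∈-filter⁻ (indep? e) (f∈ i)

    g : Fin (suc k) → A × A
    g zero    = e
    g (suc i) = f i

    g∈ : ∀ i → g i ∈ es
    g∈ zero    = e∈
    g∈ (suc i) = proj₁ (f∈′ i)

    g-ind : ∀ {i j} → i ≢ j → ¬ (proj₁ (g i) ≼ proj₂ (g j))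
    g-ind {zero}  {zero}  i≢j = contradiction refl i≢j
    g-ind {zero}  {suc j} _   = proj₁ (proj₂ (f∈′ j))
    g-ind {suc i} {zero}  _   = proj₂ (proj₂ (f∈′ i))
    g-ind {suc i} {suc j} i≢j = f-ind (i≢j ∘ cong suc)

  indep⇒clique : ∀ k {es} (f : Fin k → A × A) → PairwiseIndep es f → Clique k es
  indep⇒clique zero    f _            = tt
  indep⇒clique (suc k) f (f∈ , f-ind) = lose (f∈ zero) (indep⇒clique k (f ∘ suc)
    ( (λ i → ∈-filter⁺ (indep? (f zero)) (f∈ (suc i)) (f-ind (λ ()) , f-ind (λ ())))
    , λ i≢j → f-ind (i≢j ∘ Fin.suc-injective)))

  edges : List A → List (A × A)
  edges xs = filter edge? (cartesianProduct xs xs)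

  matching? : ∀ k xs → Dec (Matching _≼_ (Fin k) (_∈ xs))
  matching? k xs = map′ to from (clique? k (edges xs))
    where
    to : Clique k (edges xs) → Matching _≼_ (Fin k) (_∈ xs)
    to c with clique⇒indep k c
    ... | f , f∈ , f-ind = record
      { lo = proj₁ ∘ f ; hi = proj₂ ∘ f
      ; lo∈ = λ i → proj₁ (∈-cartesianProduct⁻ xs xs (proj₁ (f∈′ i)))
      ; hi∈ = λ i → proj₂ (∈-cartesianProduct⁻ xs xs (proj₁ (f∈′ i)))
      ; lo≼hi = λ i → proj₁ (proj₂ (f∈′ i))
      ; hi⋠lo = λ i → proj₂ (proj₂ (f∈′ i))
      ; lo⋠hi = f-ind }
      where
      f∈′ : ∀ i → f i ∈ cartesianProduct xs xs × Edge (f i)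
      f∈′ i = ∈-filter⁻ edge? (f∈ i)

    from : Matching _≼_ (Fin k) (_∈ xs) → Clique k (edges xs)
    from M = indep⇒clique k (λ i → lo M i , hi M i)
      ( (λ i → ∈-filter⁺ edge? (∈-cartesianProduct⁺ (lo∈ M i) (hi∈ M i)) (lo≼hi M i , hi⋠lo M i))
      , lo⋠hi M)

-- Greedy saturation

_≟ˢ_ : ∀ {n} (p q : Subset n) → Dec (p ≡ q)
_≟ˢ_ = Vec.≡-dec Bool._≟_

Copy : ∀ {n} → ℕ → Family n → Set
Copy m 𝓕 = Matching _⊆_ (Fin m) (_∈ 𝓕)

-- `𝓔` lists the sets still to be tried; each is added unless it is present or creates a copy. The
-- invariant is that every set outside `𝓕` and `𝓔` creates a copy, which survives when `𝓕` grows.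
-- Once `𝓔` is empty, this is saturation.
saturate : ∀ {n m} (𝓔 𝓕 : Family n) → Unique 𝓕 → ¬ Copy m 𝓕 →
           (∀ G → G ∉ 𝓕 → G ∉ 𝓔 → Copy m (G ∷ 𝓕)) →
           SatStar≤ (mC₂ m) n (length 𝓔 + length 𝓕)
saturate [] 𝓕 uniq free create =
  𝓕 , uniq , (free ∘ copy⇒matching , λ G G∉ → matching⇒copy (create G G∉ λ ())) , ℕ.≤-refl
saturate {n} {m} (E ∷ 𝓔) 𝓕 uniq free create with any? (E ≟ˢ_) 𝓕
... | yes E∈ = let 𝓕′ , u , s , l = saturate 𝓔 𝓕 uniq free
                     (λ G G∉ G∉𝓔 → create G G∉ λ { (here refl) → G∉ E∈ ; (there G∈) → G∉𝓔 G∈ })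
               in 𝓕′ , u , s , ℕ.m≤n⇒m≤1+n l
... | no E∉ with matching? _⊆?_ m (E ∷ 𝓕)
... | yes c = let 𝓕′ , u , s , l = saturate 𝓔 𝓕 uniq free
                    skip
              in 𝓕′ , u , s , ℕ.m≤n⇒m≤1+n l
  where
  skip : ∀ G → G ∉ 𝓕 → G ∉ 𝓔 → Copy m (G ∷ 𝓕)
  skip G G∉ G∉𝓔 with G ≟ˢ E
  ... | yes refl = c
  ... | no G≢E   = create G G∉ λ { (here G≡E) → G≢E G≡E ; (there G∈) → G∉𝓔 G∈ }
... | no ¬c = let 𝓕′ , u , s , l = saturate 𝓔 (E ∷ 𝓕) (¬Any⇒All¬ 𝓕 E∉ ∷ uniq) ¬c
                    (λ G G∉ G∉𝓔 → weaken (λ { (here p) → here p ; (there p) → there (there p) })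
                      (create G (G∉ ∘ there) λ { (here G≡E) → G∉ (here G≡E) ; (there G∈) → G∉𝓔 G∈ }))
              in 𝓕′ , u , s , subst (length 𝓕′ ≤_) (ℕ.+-suc (length 𝓔) (length 𝓕)) l

-- Pigeonhole for three indices

Triple : ∀ {m n} → (Fin m → Fin n) → Set
Triple {m} f = Σ (Fin 3 → Fin m) λ g → Injective _≡_ _≡_ g × (∀ a b → f (g a) ≡ f (g b))

-- Ordinary pigeonhole, applied to f i together with a bit telling whether the
-- value f i already occurs at a smaller index.
pigeonhole₃ : ∀ q (f : Fin (suc (q * 2)) → Fin q) → Triple f
pigeonhole₃ q f = result
  where
  Repeat : Fin (suc (q * 2)) → Set
  Repeat i = ∃[ j ] (j <ᶠ i) × (f j ≡ f i)

  repeat? : ∀ i → Dec (Repeat i)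
  repeat? i = Fin.any? λ j → (j Fin.<? i) ×-dec (f j ≟ f i)

  bit : ∀ {i} → Dec (Repeat i) → Fin 2
  bit (yes _) = 1F
  bit (no _)  = 0F

  triple : ∀ {i j k} → k <ᶠ i → i <ᶠ j → f k ≡ f i → f i ≡ f j →
           Triple f
  triple {i} {j} {k} k<i i<j fk≡fi fi≡fj = g , g-inj , λ a b → trans (eq a) (sym (eq b))
    where
    g : Fin 3 → Fin (suc (q * 2))
    g 0F = k
    g 1F = i
    g 2F = j
    eq : ∀ a → f (g a) ≡ f i
    eq 0F = fk≡fi
    eq 1F = refl
    eq 2F = sym fi≡fj
    k<j : k <ᶠ j
    k<j = ℕ.<-trans k<i i<j
    g-inj : Injective _≡_ _≡_ g
    g-inj {0F} {0F} _ = refl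
    g-inj {0F} {1F} e = contradiction e (Fin.<⇒≢ k<i)
    g-inj {0F} {2F} e = contradiction e (Fin.<⇒≢ k<j)
    g-inj {1F} {0F} e = contradiction (sym e) (Fin.<⇒≢ k<i)
    g-inj {1F} {1F} _ = refl
    g-inj {1F} {2F} e = contradiction e (Fin.<⇒≢ i<j)
    g-inj {2F} {0F} e = contradiction (sym e) (Fin.<⇒≢ k<j)
    g-inj {2F} {1F} e = contradiction (sym e) (Fin.<⇒≢ i<j)
    g-inj {2F} {2F} _ = refl

  result : Triple f
  result with Fin.pigeonhole (ℕ.n<1+n (q * 2)) (λ i → combine (f i) (bit (repeat? i)))
  ... | i , j , i<j , e with Fin.combine-injective (f i) (bit (repeat? i)) (f j) (bit (repeat? j)) e
  ... | fi≡fj , b with repeat? i | repeat? j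
  -- If `i` repeats the value of an earlier `k`, then `k`, `i`, `j` form the triple. Otherwise the
  -- bits of `i` and `j` differ, since `j` repeats `i`.
  ... | yes (k , k<i , fk≡fi) | _    = triple k<i i<j fk≡fi fi≡fj
  ... | no _ | no ¬r = contradiction (i , i<j , fi≡fj) ¬r
  ... | no _ | yes _ = case b of λ ()

-- The gadget on four singletons and R

allSubsets : ∀ n → List (Subset n)
allSubsets zero    = [ [] ]
allSubsets (suc n) = map (inside ∷_) (allSubsets n) ++ map (outside ∷_) (allSubsets n)

∈-allSubsets : ∀ {n} (p : Subset n) → p ∈ allSubsets n
∈-allSubsets []            = here refl
∈-allSubsets (inside  ∷ p) = ∈-++⁺ˡ (∈-map⁺ (inside ∷_) (∈-allSubsets p))
∈-allSubsets (outside ∷ p) = ∈-++⁺ʳ _ (∈-map⁺ (outside ∷_) (∈-allSubsets p))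

length-allSubsets : ∀ n → length (allSubsets n) ≡ 2 ^ n
length-allSubsets zero    = refl
length-allSubsets (suc n) =
  trans (length-++ (map (inside ∷_) (allSubsets n)))
    (cong₂ _+_ (half inside) (trans (half outside) (sym (ℕ.+-identityʳ (2 ^ n)))))
  where
  half : ∀ s → length (map (s ∷_) (allSubsets n)) ≡ 2 ^ n
  half s = trans (length-map (s ∷_) (allSubsets n)) (length-allSubsets n)

-- The second component describes the intersection with R: 0F is ∅, 2F is R, and
-- 1F is the proper nonempty subset S cut out of R by the set to be added.
Point : Set
Point = Subset 4 × Fin 3

_⊑_ : Point → Point → Set
(X , l) ⊑ (Y , k) = (X ⊆ Y) × (l ≤ᶠ k)

_⊑?_ : Decidable _⊑_
(X , l) ⊑? (Y , k) = (X ⊆? Y) ×-dec (l Fin.≤? k)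

pattern I = inside
pattern O = outside

lower upper gadget : List Point
lower = map (_, 0F)
  ( (I ∷ O ∷ O ∷ O ∷ []) ∷ (O ∷ I ∷ O ∷ O ∷ []) ∷ (O ∷ O ∷ I ∷ O ∷ []) ∷ (O ∷ O ∷ O ∷ I ∷ [])
  ∷ (I ∷ O ∷ O ∷ I ∷ []) ∷ (O ∷ I ∷ I ∷ O ∷ []) ∷ [])
upper = map (_, 2F)
  ( (O ∷ I ∷ I ∷ I ∷ []) ∷ (I ∷ O ∷ I ∷ I ∷ []) ∷ (I ∷ I ∷ O ∷ I ∷ []) ∷ (I ∷ I ∷ I ∷ O ∷ [])
  ∷ (I ∷ O ∷ I ∷ O ∷ []) ∷ (O ∷ I ∷ O ∷ I ∷ []) ∷ [])
gadget = lower ++ upper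

abstract

  -- For instance 0 ⊂ 03 and 1 ⊂ 12.
  lower-matching : Matching _⊑_ (Fin 2) (_∈ lower)
  lower-matching = toWitness {a? = matching? _⊑?_ 2 lower} _

  -- For instance 02 ⊂ 023 and 13 ⊂ 013, with R added to all four sets.
  upper-matching : Matching _⊑_ (Fin 2) (_∈ upper)
  upper-matching = toWitness {a? = matching? _⊑?_ 2 upper} _

  gadget-free : ¬ Matching _⊑_ (Fin 3) (_∈ gadget)
  gadget-free = toWitnessFalse {a? = matching? _⊑?_ 3 gadget} _

  -- Every subset splitting R lies strictly between ∅ and R, so level `1F` stands for all of them
  -- and only the 16 choices of `P` need checking.
  gadget-saturated : ∀ P → Matching _⊑_ (Fin 3) (_∈ ((P , 1F) ∷ gadget))
  gadget-saturated P = All.lookup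
    (toWitness {a? = All.all? (λ P → matching? _⊑?_ 3 ((P , 1F) ∷ gadget)) (allSubsets 4)} _)
    (∈-allSubsets P)

lower-level : ∀ {x} → x ∈ lower → proj₂ x ≡ 0F
lower-level x∈ with _ , _ , refl ← ∈-map⁻ (_, 0F) x∈ = refl

upper-level : ∀ {x} → x ∈ upper → proj₂ x ≡ 2F
upper-level x∈ with _ , _ , refl ← ∈-map⁻ (_, 2F) x∈ = refl

-- Keeps pieces from lying below a `duo`.
gadget-nonempty : ∀ {x} → x ∈ gadget → proj₁ x ⊈ ⊥
gadget-nonempty = All.lookup (toWitness {a? = All.all? (λ x → ¬? (proj₁ x ⊆? ⊥)) gadget} _)

-- Keeps `cap` from lying below a piece.
gadget-nonfull : ∀ {x} → x ∈ gadget → ⊤ ⊈ proj₁ x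
gadget-nonfull = All.lookup (toWitness {a? = All.all? (λ x → ¬? (⊤ ⊆? proj₁ x)) gadget} _)

-- The core: q marked copies of the gadget, `cap` and the pairs of markers

Cell : ℕ → Set
Cell q = Subset 4 × Subset q × Fin 3

module _ {q : ℕ} where

  _⊴_ : Cell q → Cell q → Set
  (X , T , l) ⊴ (Y , U , k) = (X ⊆ Y) × (T ⊆ U) × (l ≤ᶠ k)

  place : Fin q → Point → Cell q
  place s (X , l) = X , ⁅ s ⁆ , l

  duo : Fin q × Fin q → Cell q
  duo (r , s) = ⊥ , ⁅ r ⁆ ∪ ⁅ s ⁆ , 0F

  cap : Cell q
  cap = ⊤ , ⊥ , 2F

  -- For `r ≡ s` the `duo` would have a single marker and lie below every piece of copy `r`.
  distinct? : (rs : Fin q × Fin q) → Dec (proj₁ rs ≢ proj₂ rs)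
  distinct? (r , s) = ¬? (r ≟ s)

  pieces duos core : List (Cell q)
  pieces = cartesianProductWith place (allFin q) gadget
  duos   = map duo (filter distinct? (cartesianProduct (allFin q) (allFin q)))
  core   = pieces ++ cap ∷ duos

  data InCore : Cell q → Set where
    in-piece : ∀ s {x} → x ∈ gadget → InCore (place s x)
    in-cap   : InCore cap
    in-duo   : ∀ {r s} → r ≢ s → InCore (duo (r , s))

  core⁻ : ∀ {c} → c ∈ core → InCore c
  core⁻ c∈ with ∈-++⁻ pieces c∈
  ... | inj₁ c∈′ with s , _ , _ , x∈ , refl ← ∈-cartesianProductWith⁻ place (allFin q) gadget c∈′ =
        in-piece s x∈
  ... | inj₂ (here refl) = in-cap
  ... | inj₂ (there c∈′) with _ , rs∈ , refl ← ∈-map⁻ duo c∈′ =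
        in-duo (proj₂ (∈-filter⁻ distinct? {xs = cartesianProduct (allFin q) (allFin q)} rs∈))

  core⁺ : ∀ {c} → InCore c → c ∈ core
  core⁺ (in-piece s x∈)        = ∈-++⁺ˡ (∈-cartesianProductWith⁺ place (∈-allFin s) x∈)
  core⁺ in-cap                 = ∈-++⁺ʳ pieces (here refl)
  core⁺ (in-duo {r} {s} r≢s)   = ∈-++⁺ʳ pieces (there (∈-map⁺ duo
    (∈-filter⁺ distinct? (∈-cartesianProduct⁺ (∈-allFin r) (∈-allFin s)) r≢s)))

  ⁅⁆⊆⁅⁆ : ∀ {r s : Fin q} → ⁅ r ⁆ ⊆ ⁅ s ⁆ → r ≡ s
  ⁅⁆⊆⁅⁆ {r} {s} sub = x∈⁅y⁆⇒x≡y s (sub (x∈⁅x⁆ r))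

  ⁅⁆⊈⊥ : ∀ {r : Fin q} → ⁅ r ⁆ ⊈ ⊥
  ⁅⁆⊈⊥ {r} sub = ∉⊥ (sub (x∈⁅x⁆ r))

  ∈-pairˡ : ∀ (r s : Fin q) → r ∈ˢ ⁅ r ⁆ ∪ ⁅ s ⁆
  ∈-pairˡ r s = x∈p∪q⁺ (inj₁ (x∈⁅x⁆ r))

  ∈-pairʳ : ∀ (r s : Fin q) → s ∈ˢ ⁅ r ⁆ ∪ ⁅ s ⁆
  ∈-pairʳ r s = x∈p∪q⁺ (inj₂ (x∈⁅x⁆ s))

  ∈-pair⁻ : ∀ {x} (r s : Fin q) → x ∈ˢ ⁅ r ⁆ ∪ ⁅ s ⁆ → x ≡ r ⊎ x ≡ s
  ∈-pair⁻ r s x∈ with x∈p∪q⁻ ⁅ r ⁆ ⁅ s ⁆ x∈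
  ... | inj₁ p = inj₁ (x∈⁅y⁆⇒x≡y r p)
  ... | inj₂ p = inj₂ (x∈⁅y⁆⇒x≡y s p)

  pair⊆ : ∀ {r s : Fin q} {T} → r ∈ˢ T → s ∈ˢ T → ⁅ r ⁆ ∪ ⁅ s ⁆ ⊆ T
  pair⊆ {r} {s} {T} r∈ s∈ x∈ with ∈-pair⁻ r s x∈
  ... | inj₁ refl = r∈
  ... | inj₂ refl = s∈

  pair⊈⁅⁆ : ∀ {r s u : Fin q} → r ≢ s → ⁅ r ⁆ ∪ ⁅ s ⁆ ⊈ ⁅ u ⁆
  pair⊈⁅⁆ {r} {s} {u} r≢s sub =
    r≢s (trans (x∈⁅y⁆⇒x≡y u (sub (∈-pairˡ r s))) (sym (x∈⁅y⁆⇒x≡y u (sub (∈-pairʳ r s)))))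

  -- Distinct `r` and `s` in the second pair must be `u` and `v` in some order.
  pair⊆pair : ∀ {r s u v : Fin q} → r ≢ s → ⁅ r ⁆ ∪ ⁅ s ⁆ ⊆ ⁅ u ⁆ ∪ ⁅ v ⁆ → ⁅ u ⁆ ∪ ⁅ v ⁆ ⊆ ⁅ r ⁆ ∪ ⁅ s ⁆
  pair⊆pair {r} {s} {u} {v} r≢s sub
    with ∈-pair⁻ u v (sub (∈-pairˡ r s)) | ∈-pair⁻ u v (sub (∈-pairʳ r s))
  ... | inj₁ refl | inj₁ refl = contradiction refl r≢s
  ... | inj₁ refl | inj₂ refl = λ x∈ → x∈
  ... | inj₂ refl | inj₁ refl = pair⊆ (∈-pairʳ r s) (∈-pairˡ r s)
  ... | inj₂ refl | inj₂ refl = contradiction refl r≢s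

  SamePiece : Cell q → Cell q → Set
  SamePiece c d = ∃[ s ] ∃[ x ] ∃[ y ] x ∈ gadget × y ∈ gadget × c ≡ place s x × d ≡ place s y

  -- Markers separate different copies, while `cap` and each `duo` are comparable only to
  -- themselves. Hence strict comparisons stay within one copy.
  core-edge : ∀ {c d} → InCore c → InCore d → c ⊴ d → ¬ (d ⊴ c) → SamePiece c d
  core-edge (in-piece r x∈) (in-piece s y∈) (_ , sub , _) _ with refl ← ⁅⁆⊆⁅⁆ sub =
    r , _ , _ , x∈ , y∈ , refl , refl
  core-edge (in-piece r x∈) in-cap       (_ , sub , _) _   = ⊥-elim (⁅⁆⊈⊥ sub)
  core-edge (in-piece r x∈) (in-duo _)   (sub , _ , _) _   = ⊥-elim (gadget-nonempty x∈ sub)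
  core-edge in-cap (in-piece s y∈)       (sub , _ , _) _   = ⊥-elim (gadget-nonfull y∈ sub)
  core-edge in-cap in-cap                c⊴d           c⋬d = ⊥-elim (c⋬d c⊴d)
  core-edge in-cap (in-duo _)            (_ , _ , ())  _
  core-edge (in-duo r≢s) (in-piece s y∈) (_ , sub , _) _   = ⊥-elim (pair⊈⁅⁆ r≢s sub)
  core-edge (in-duo {r} {s} _) in-cap    (_ , sub , _) _   = ⊥-elim (∉⊥ (sub (∈-pairˡ r s)))
  core-edge (in-duo r≢s) (in-duo _)      (_ , sub , _) d⋬c = ⊥-elim (d⋬c (⊥⊆ , pair⊆pair r≢s sub , z≤n))

  place-cancel : ∀ {r s x y} → place r x ⊴ place s y → r ≡ s × x ⊑ y
  place-cancel (X⊆Y , sub , l≤k) = ⁅⁆⊆⁅⁆ sub , (X⊆Y , l≤k)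

  place-mono : ∀ s {x y} → x ⊑ y → place s x ⊴ place s y
  place-mono s (X⊆Y , l≤k) = X⊆Y , (λ z → z) , l≤k

  single-piece : (M : Matching _⊴_ (Fin 3) (_∈ core)) →
                 (same : ∀ i → SamePiece (lo M i) (hi M i)) →
                 (∀ a b → proj₁ (same a) ≡ proj₁ (same b)) →
                 Matching _⊑_ (Fin 3) (_∈ gadget)
  single-piece M same agree = record
    { lo    = x
    ; hi    = y
    ; lo∈   = λ i → proj₁ (proj₂ (proj₂ (proj₂ (same i))))
    ; hi∈   = λ i → proj₁ (proj₂ (proj₂ (proj₂ (proj₂ (same i)))))
    ; lo≼hi = λ i → proj₂ (place-cancel (subst₂ _⊴_ (lo-eq i) (hi-eq i) (lo≼hi M i)))
    ; hi⋠lo = λ i y⊑x → hi⋠lo M i (subst₂ _⊴_ (sym (hi-eq i)) (sym (lo-eq i)) (place-mono _ y⊑x))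
    ; lo⋠hi = λ {i} {j} i≢j x⊑y → lo⋠hi M i≢j (subst₂ _⊴_ (sym (lo-eq i)) (sym (hi-eq j))
                (subst (λ s → place (proj₁ (same i)) (x i) ⊴ place s (y j)) (agree i j) (place-mono (proj₁ (same i)) x⊑y))) }
    where
    x y : Fin 3 → Point
    x i = proj₁ (proj₂ (same i))
    y i = proj₁ (proj₂ (proj₂ (same i)))
    lo-eq : ∀ i → lo M i ≡ place (proj₁ (same i)) (x i)
    lo-eq i = proj₁ (proj₂ (proj₂ (proj₂ (proj₂ (proj₂ (same i))))))
    hi-eq : ∀ i → hi M i ≡ place (proj₁ (same i)) (y i)
    hi-eq i = proj₂ (proj₂ (proj₂ (proj₂ (proj₂ (proj₂ (same i))))))

  -- Each of the 2q + 1 edges lies in one of q copies, so three of them share a copy; without their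
  -- marker they would form a matching excluded by `gadget-free`.
  core-free : ¬ Matching _⊴_ (Fin (suc (q * 2))) (_∈ core)
  core-free M =
    let same : ∀ i → SamePiece (lo M i) (hi M i)
        same i = core-edge (core⁻ (lo∈ M i)) (core⁻ (hi∈ M i)) (lo≼hi M i) (hi⋠lo M i)
        g , g-inj , agree = pigeonhole₃ q (λ i → proj₁ (same i))
    in gadget-free (single-piece (reindex g g-inj M) (λ a → same (g a)) agree)

  -- Edges from different copies are independent because their markers differ. `P` depends on the
  -- copy so that `create-single` can treat copy `s` separately.
  piecewise : {P : Fin q → Point → Set} {R : Cell q → Set} →
              (∀ r {x} → P r x → R (place r x)) →
              (∀ r → Matching _⊑_ (Fin 2) (P r)) → Matching _⊴_ (Fin q × Fin 2) R
  piecewise P⇒R M = record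
    { lo    = λ (r , j) → place r (lo (M r) j)
    ; hi    = λ (r , j) → place r (hi (M r) j)
    ; lo∈   = λ (r , j) → P⇒R r (lo∈ (M r) j)
    ; hi∈   = λ (r , j) → P⇒R r (hi∈ (M r) j)
    ; lo≼hi = λ (r , j) → place-mono r (lo≼hi (M r) j)
    ; hi⋠lo = λ (r , j) → hi⋠lo (M r) j ∘ proj₂ ∘ place-cancel
    ; lo⋠hi = λ { {r , j} {s , k} i≢j le → case place-cancel le of λ
                  { (refl , x⊑y) → lo⋠hi (M r) (i≢j ∘ cong (r ,_)) x⊑y } } }

  create-∅ : ∀ P → Matching _⊴_ (Maybe (Fin q × Fin 2)) (_∈ ((P , ⊥ , 1F) ∷ core))
  create-∅ P = addEdge
    (piecewise {P = λ _ → _∈ lower} (λ r x∈ → there (core⁺ (in-piece r (∈-++⁺ˡ x∈)))) (λ _ → lower-matching))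
    -- The extra edge leads from the new set up to `cap`. Pieces have a marker, so none is below
    -- `cap`; lower pieces avoid R, so none is above the new set.
    (here refl) (there (core⁺ in-cap))
    (⊆⊤ , (λ z → z) , s≤s z≤n) (λ { (_ , _ , s≤s ()) })
    (λ { (r , j) (_ , sub , _) → ⁅⁆⊈⊥ sub })
    (λ { (r , j) (_ , _ , 1≤l) → case subst (_≤ᶠ_ {3} {3} 1F) (lower-level (hi∈ lower-matching j)) 1≤l of λ () })

  create-duo : ∀ P {T r s} → r ≢ s → r ∈ˢ T → s ∈ˢ T →
               Matching _⊴_ (Maybe (Fin q × Fin 2)) (_∈ ((P , T , 1F) ∷ core))
  create-duo P {T} {r} {s} r≢s r∈ s∈ = addEdge
    (piecewise {P = λ _ → _∈ upper} (λ r x∈ → there (core⁺ (in-piece r (∈-++⁺ʳ lower x∈)))) (λ _ → upper-matching))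
    -- The extra edge leads from a pair of markers up to the new set. Upper pieces contain R, so
    -- none is below the new set; they have one marker, so none is above the pair.
    (there (core⁺ (in-duo r≢s))) (here refl)
    (⊥⊆ , pair⊆ r∈ s∈ , z≤n) (λ { (_ , _ , ()) })
    (λ { (_ , j) (_ , _ , l≤1) → case subst (λ l → _≤ᶠ_ {3} {3} l 1F) (upper-level (lo∈ upper-matching j)) l≤1 of λ { (s≤s ()) } })
    (λ { (_ , j) (_ , sub , _) → pair⊈⁅⁆ r≢s sub })

  create-single : ∀ P s → Matching _⊴_ (Maybe (Fin q × Fin 2)) (_∈ ((P , ⁅ s ⁆ , 1F) ∷ core))
  -- Edges 0 and 1 of `N` serve as the two edges of copy `s`, and edge 2 is the extra one.
  create-single P s = addEdge (piecewise {P = Q} Q⇒ (λ r → choose r (r ≟ s)))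
    (placed (lo∈ N 2F)) (placed (hi∈ N 2F))
    (place-mono s (lo≼hi N 2F)) (hi⋠lo N 2F ∘ proj₂ ∘ place-cancel)
    (λ { (r , j) → lo⋠ r j (r ≟ s) }) (λ { (r , j) → ⋠hi r j (r ≟ s) })
    where
    N : Matching _⊑_ (Fin 3) (_∈ ((P , 1F) ∷ gadget))
    N = gadget-saturated P

    Q : Fin q → Point → Set
    Q r x = place r x ∈ ((P , ⁅ s ⁆ , 1F) ∷ core)

    Q⇒ : ∀ r {x} → Q r x → place r x ∈ ((P , ⁅ s ⁆ , 1F) ∷ core)
    Q⇒ r x∈ = x∈

    placed : ∀ {x} → x ∈ ((P , 1F) ∷ gadget) → Q s x
    placed (here refl) = here refl
    placed (there x∈)  = there (core⁺ (in-piece s x∈))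

    choose : ∀ r → Dec (r ≡ s) → Matching _⊑_ (Fin 2) (Q r)
    choose r (yes refl) = weaken placed (reindex inject₁ Fin.inject₁-injective N)
    choose r (no _)     = weaken (λ x∈ → there (core⁺ (in-piece r (∈-++⁺ˡ x∈)))) lower-matching

    inject₁≢2 : ∀ (j : Fin 2) → inject₁ j ≢ 2F
    inject₁≢2 0F ()
    inject₁≢2 1F ()

    lo⋠ : ∀ r j (d : Dec (r ≡ s)) → ¬ (place r (lo (choose r d) j) ⊴ place s (hi N 2F))
    lo⋠ r j (yes refl) = lo⋠hi N (inject₁≢2 j) ∘ proj₂ ∘ place-cancel
    lo⋠ r j (no r≢s)   = r≢s ∘ proj₁ ∘ place-cancel

    ⋠hi : ∀ r j (d : Dec (r ≡ s)) → ¬ (place s (lo N 2F) ⊴ place r (hi (choose r d) j))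
    ⋠hi r j (yes refl) = lo⋠hi N (inject₁≢2 j ∘ sym) ∘ proj₂ ∘ place-cancel
    ⋠hi r j (no r≢s)   = r≢s ∘ sym ∘ proj₁ ∘ place-cancel

  two-elements : ∀ {T : Subset q} {r} → r ∈ˢ T → T ≡ ⁅ r ⁆ ⊎ (∃[ s ] r ≢ s × s ∈ˢ T)
  two-elements {T} {r} r∈ with Fin.any? (λ s → ¬? (r ≟ s) ×-dec (s ∈? T))
  ... | yes found = inj₂ found
  ... | no ¬found = inj₁ (⊆-antisym T⊆ λ x∈ → subst (_∈ˢ T) (sym (x∈⁅y⁆⇒x≡y r x∈)) r∈)
    where
    T⊆ : T ⊆ ⁅ r ⁆
    T⊆ {x} x∈ with r ≟ x
    ... | yes refl = x∈⁅x⁆ r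
    ... | no r≢x   = contradiction (x , r≢x , x∈) ¬found

  -- The cases are no marker, exactly one, and at least two.
  create : ∀ P T → Matching _⊴_ (Maybe (Fin q × Fin 2)) (_∈ ((P , T , 1F) ∷ core))
  create P T with nonempty? T
  ... | no empty with refl ← Empty-unique empty = create-∅ P
  ... | yes (r , r∈) with two-elements r∈
  ...   | inj₁ refl            = create-single P r
  ...   | inj₂ (s , r≢s , s∈) = create-duo P r≢s r∈ s∈

-- Cells as subsets of the ground set

++-⊆⁺ : ∀ {m n} {p p′ : Subset m} {r r′ : Subset n} → p ⊆ p′ → r ⊆ r′ → p Vec.++ r ⊆ p′ Vec.++ r′
++-⊆⁺ {p = []}    {[]}     _    r⊆r′ x∈         = r⊆r′ x∈
++-⊆⁺ {p = _ ∷ _} {_ ∷ _} p⊆p′ r⊆r′ here with here ← p⊆p′ here = here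
++-⊆⁺ {p = _ ∷ p} {_ ∷ p′} p⊆p′ r⊆r′ (there x∈) =
  there (++-⊆⁺ {p = p} {p′} (drop-∷-⊆ p⊆p′) r⊆r′ x∈)

++-⊆⁻ : ∀ {m n} (p p′ : Subset m) {r r′ : Subset n} → p Vec.++ r ⊆ p′ Vec.++ r′ → (p ⊆ p′) × (r ⊆ r′)
++-⊆⁻ []      []        sub = (λ ()) , sub
++-⊆⁻ (s ∷ p) (s′ ∷ p′) {r} {r′} sub = p⊆p′ , proj₂ rec
  where
  rec : (p ⊆ p′) × (r ⊆ r′)
  rec = ++-⊆⁻ p p′ (drop-∷-⊆ sub)
  p⊆p′ : s ∷ p ⊆ s′ ∷ p′
  p⊆p′ here with here ← sub here = here
  p⊆p′ (there x∈) = there (proj₁ rec x∈)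

level : ∀ {r} → Subset r → Fin 3 → Subset r
level S 0F = ⊥
level S 1F = S
level S 2F = ⊤

-- These are the sets splitting R, for which ∅, `S` and R form a strict chain.
Generic : ∀ {r} → Subset r → Set
Generic S = Nonempty S × (∃[ x ] x ∉ˢ S)

level-mono : ∀ {r} (S : Subset r) l k → l ≤ᶠ k → level S l ⊆ level S k
level-mono S 0F k  _ x∈ = ⊥⊆ x∈
level-mono S 1F 1F _ x∈ = x∈
level-mono S l  2F _ x∈ = ∈⊤
level-mono S 1F 0F ()
level-mono S 2F 0F ()
level-mono S 2F 1F (s≤s ())

level-cancel : ∀ {r} {S : Subset r} → Generic S → ∀ l k → level S l ⊆ level S k → l ≤ᶠ k
level-cancel _ 0F k  _ = z≤n
level-cancel _ 1F 1F _ = s≤s z≤n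
level-cancel _ 1F 2F _ = s≤s z≤n
level-cancel _ 2F 2F _ = s≤s (s≤s z≤n)
level-cancel ((x , x∈) , _) 1F 0F sub = contradiction (sub x∈) ∉⊥
level-cancel ((x , x∈) , _) 2F 0F sub = contradiction (sub (∈⊤ {x = x})) ∉⊥
level-cancel (_ , (x , x∉)) 2F 1F sub = contradiction (sub ∈⊤) x∉

generic? : ∀ {r} (S : Subset r) → S ≡ ⊥ ⊎ S ≡ ⊤ ⊎ Generic S
generic? S with nonempty? S | Fin.any? (λ x → ¬? (x ∈? S))
... | no empty | _       = inj₁ (Empty-unique empty)
... | yes ne   | yes gap = inj₂ (inj₂ (ne , gap))
... | yes _    | no full = inj₂ (inj₁ (⊆-antisym ⊆⊤ λ {x} _ → all∈ x))
  where
  all∈ : ∀ x → x ∈ˢ S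
  all∈ x with x ∈? S
  ... | yes x∈ = x∈
  ... | no x∉  = contradiction (x , x∉) full

module _ {q r : ℕ} where

  embed : Subset r → Cell q → Subset (4 + (q + r))
  embed S (X , T , l) = X Vec.++ (T Vec.++ level S l)

  embed-mono : ∀ S {c d} → c ⊴ d → embed S c ⊆ embed S d
  embed-mono S {X , T , l} {Y , U , k} (X⊆Y , T⊆U , l≤k) =
    ++-⊆⁺ {p = X} {Y} X⊆Y (++-⊆⁺ {p = T} {U} T⊆U (level-mono S l k l≤k))

  embed-cancel : ∀ {S} → Generic S → ∀ {c d} → embed S c ⊆ embed S d → c ⊴ d
  embed-cancel gen {X , T , l} {Y , U , k} sub =
    let X⊆Y , sub′ = ++-⊆⁻ X Y sub
        T⊆U , sub″ = ++-⊆⁻ T U sub′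
    in X⊆Y , T⊆U , level-cancel gen l k sub″

  embed-gadget : ∀ S S′ s {x} → x ∈ gadget → embed S (place s x) ≡ embed S′ (place s x)
  embed-gadget S S′ s x∈ with ∈-++⁻ lower x∈
  ... | inj₁ x∈′ rewrite lower-level x∈′ = refl
  ... | inj₂ x∈′ rewrite upper-level x∈′ = refl

  -- No core cell has level `1F`, so one and the same family serves for every `S`.
  embed-core : ∀ S S′ {c} → InCore c → embed S c ≡ embed S′ c
  embed-core S S′ (in-piece s x∈) = embed-gadget S S′ s x∈
  embed-core S S′ in-cap          = refl
  embed-core S S′ (in-duo _)      = refl

  -- `S` is the trace of `G` on R and may still be ∅ or R.
  split : ∀ G → ∃[ P ] ∃[ T ] ∃[ S ] G ≡ embed S (P , T , 1F)
  split G with P , G′ , refl ← Vec.splitAt 4 G with T , S , refl ← Vec.splitAt q G′ = P , T , S , refl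

-- The bound for an odd number of chains, and the central binomial coefficient

blocks : ∀ q → List (Cell q)
blocks q = cartesianProduct (allSubsets 4) (cartesianProduct (allSubsets q) (0F ∷ 2F ∷ []))

∈-blocks : ∀ {q} X (T : Subset q) {l} → l ∈ (0F ∷ 2F ∷ []) → (X , T , l) ∈ blocks q
∈-blocks X T l∈ = ∈-cartesianProduct⁺ (∈-allSubsets X) (∈-cartesianProduct⁺ (∈-allSubsets T) l∈)

-- Index `zero` is the extra edge; the others number two edges in each copy.
maybe-remQuot : ∀ q → Fin (suc (q * 2)) → Maybe (Fin q × Fin 2)
maybe-remQuot q zero    = nothing
maybe-remQuot q (suc i) = just (remQuot {q} 2 i)

maybe-remQuot-injective : ∀ q → Injective _≡_ _≡_ (maybe-remQuot q)
maybe-remQuot-injective q {zero}  {zero}  _ = refl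
maybe-remQuot-injective q {suc i} {suc j} e = cong suc (trans (sym (Fin.combine-remQuot {q} 2 i))
  (trans (cong (λ (a , b) → combine a b) (just-injective e)) (Fin.combine-remQuot {q} 2 j)))

-- R has `r + 2` elements, so a set `S₀` splitting it exists. The bound does not involve `r`.
bounded-large : ∀ q r → SatStar≤ (mC₂ (suc (q * 2))) (4 + (q + suc (suc r))) (length (blocks q) + length (core {q}))
bounded-large q r =
  -- Repetitions do occur: `duo (r , s)` and `duo (s , r)` are the same set.
  let 𝓕 , uniq , sat , len = saturate 𝓔 (deduplicate _≟ˢ_ 𝓕₀) (Unique.deduplicate-! _≟ˢ_ 𝓕₀) free new
  in 𝓕 , uniq , sat , ℕ.≤-trans len (ℕ.+-mono-≤ (ℕ.≤-reflexive (length-map (embed S₀) (blocks q)))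
       (ℕ.≤-trans (length-deduplicate _≟ˢ_ 𝓕₀) (ℕ.≤-reflexive (length-map (embed S₀) (core {q})))))
  where
  S₀ : Subset (suc (suc r))
  S₀ = ⁅ zero ⁆

  S₀-generic : Generic S₀
  S₀-generic = (zero , here) , (suc zero , λ { (there ()) })

  𝓕₀ 𝓔 : Family (4 + (q + suc (suc r)))
  𝓕₀ = map (embed S₀) core
  -- The candidates are the unions of blocks; every other set splits R.
  𝓔  = map (embed S₀) (blocks q)

  free : ¬ Copy (suc (q * 2)) (deduplicate _≟ˢ_ 𝓕₀)
  free M = core-free (preimage (embed S₀) (λ {c} {d} → embed-mono S₀ {c} {d}) (embed-cancel S₀-generic)
    (λ X∈ → ∈-map⁻ (embed S₀) (∈-deduplicate⁻ _≟ˢ_ 𝓕₀ X∈)) M)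

  new : ∀ G → G ∉ deduplicate _≟ˢ_ 𝓕₀ → G ∉ 𝓔 → Copy (suc (q * 2)) (G ∷ deduplicate _≟ˢ_ 𝓕₀)
  new G _ G∉𝓔 with P , T , S , refl ← split {q} G with generic? S
  ... | inj₁ refl        = contradiction (∈-map⁺ (embed S₀) (∈-blocks P T (here refl))) G∉𝓔
  ... | inj₂ (inj₁ refl) = contradiction (∈-map⁺ (embed S₀) (∈-blocks P T (there (here refl)))) G∉𝓔
  -- Reading the core through `S` instead of `S₀` keeps its sets and makes `G` a cell of level `1F`.
  ... | inj₂ (inj₂ gen)  = reindex (maybe-remQuot q) (maybe-remQuot-injective q)
    (image (embed S) (λ {c} {d} → embed-mono S {c} {d}) (embed-cancel gen) member (create P T))
    where
    member : ∀ {c} → c ∈ ((P , T , 1F) ∷ core) → embed S c ∈ (embed S (P , T , 1F) ∷ deduplicate _≟ˢ_ 𝓕₀)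
    member (here refl) = here refl
    member {c} (there c∈)  = there (∈-deduplicate⁺ _≟ˢ_
      (subst (_∈ 𝓕₀) (embed-core S₀ S (core⁻ c∈)) (∈-map⁺ (embed S₀) c∈)))

-- Greedy saturation starts from the empty family, with all subsets as candidates.
bounded-small : ∀ m n → SatStar≤ (mC₂ (suc m)) n (2 ^ n)
bounded-small m n = subst (SatStar≤ (mC₂ (suc m)) n) (trans (ℕ.+-identityʳ _) (length-allSubsets n))
  (saturate (allSubsets n) [] [] (λ M → case lo∈ M zero of λ ())
    (λ G _ G∉ → contradiction (∈-allSubsets G) G∉))

SatStar≤-mono : ∀ {m n K L} → K ≤ L → SatStar≤ (mC₂ m) n K → SatStar≤ (mC₂ m) n L
SatStar≤-mono K≤L (𝓕 , uniq , sat , len) = 𝓕 , uniq , sat , ℕ.≤-trans len K≤L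

odd-bounded : ∀ q → ∃[ K ] (∀ n → SatStar≤ (mC₂ (suc (q * 2))) n K)
-- `bounded-large` covers n ≥ 6 + q: four singletons, q markers and at least two elements in R. For
-- smaller n the power of 2 suffices.
odd-bounded q = 2 ^ (5 + q) + B , bound
  where
  B : ℕ
  B = length (blocks q) + length (core {q})

  bound : ∀ n → SatStar≤ (mC₂ (suc (q * 2))) n (2 ^ (5 + q) + B)
  bound n with ℕ.≤-<-connex n (5 + q)
  ... | inj₁ n≤5+q = SatStar≤-mono (ℕ.≤-trans (ℕ.^-monoʳ-≤ 2 n≤5+q) (ℕ.m≤m+n (2 ^ (5 + q)) B)) (bounded-small (q * 2) n)
  ... | inj₂ 6+q≤n = SatStar≤-mono (ℕ.m≤n+m B (2 ^ (5 + q)))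
    (subst (λ n → SatStar≤ (mC₂ (suc (q * 2))) n B) n-eq (bounded-large q (n ∸ (6 + q))))
    where
    n-eq : 4 + (q + suc (suc (n ∸ (6 + q)))) ≡ n
    n-eq = trans (cong (4 +_) (trans (ℕ.+-suc q _) (cong suc (ℕ.+-suc q _)))) (ℕ.m+[n∸m]≡n 6+q≤n)

-- Pascal's rule gives two neighbouring entries of row 2k + 1, which are equal by symmetry.
central-binomial-even : ∀ k → (2 * suc k) C suc k ≡ ((k + suc (k + 0)) C k) * 2
central-binomial-even k = begin
  suc n C suc k       ≡⟨ nCk+nC[k+1]≡[n+1]C[k+1] n k ⟨
  n C k + n C suc k   ≡⟨ cong (λ j → n C k + n C suc j) (ℕ.+-identityʳ k) ⟨
  n C k + n C suc (k + 0) ≡⟨ cong (λ j → n C k + n C j) (ℕ.m+n∸m≡n k (suc (k + 0))) ⟨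
  n C k + n C (n ∸ k) ≡⟨ cong (n C k +_) (nCk≡nC[n∸k] (ℕ.m≤m+n k _)) ⟨
  n C k + n C k       ≡⟨ cong (n C k +_) (ℕ.+-identityʳ (n C k)) ⟨
  2 * (n C k)         ≡⟨ ℕ.*-comm 2 (n C k) ⟩
  (n C k) * 2         ∎
  where
  open ≡-Reasoning
  n : ℕ
  n = k + suc (k + 0)

theorem1p6 : ∀ (t : ℕ) → 2 ≤ t →
    ∃[ K ] (∀ (n : ℕ) → 1 ≤ n → SatStar≤ (mC₂ (((2 * t) C t) + 1)) n K)
theorem1p6 (suc k) _ =
  -- The number q of gadgets is half the central binomial coefficient for `t = suc k`.
  let K , bound = odd-bounded ((k + suc (k + 0)) C k)
  in K , λ n _ → subst (λ m → SatStar≤ (mC₂ m) n K)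
       (trans (cong suc (sym (central-binomial-even k))) (ℕ.+-comm 1 _)) (bound n)
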